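{- Let $n\in\mathbb{N}$ and let $A$ be an $n\times n$ acyclic real symmetric matrix. Suppose $\lambda$ is an eigenvalue of $A$ of multiplicity one and $u\in[n]$ is an index with $\phi(A-u,\lambda)\neq 0$. Define $\boldsymbol{\alpha}\in\mathbb{R}^n$ by \[ \boldsymbol{\alpha}(v)=\begin{cases} W(P_{u,v})\,\phi(A-P_{u,v},\lambda) & \text{if there is a path from } u \text{ to } v \text{ in } G(A),\\ 0 & \text{otherwise}.\end{cases} \] Then $\boldsymbol{\alpha}$ is a $\lambda$-eigenvector of $A$.
   Context: $[n]=\{1,\ldots,n\}$. For a real symmetric $n\times n$ matrix $A$, its graph $G(A)$ has vertex set $[n]$, with $u\neq v$ adjacent iff $A_{uv}\neq 0$; each edge $uv$ has weight $w(uv)=A_{uv}$ and each vertex $v$ has weight $w(v)=A_{vv}$. $A$ is called acyclic if $G(A)$ is a forest (i.e. $A$ is the adjacency matrix of a weighted forest with nonzero real edge weights and possibly vertex weights). When $u,v$ lie in the same component of the forest, $P_{u,v}$ denotes the unique path between them (a single vertex if $u=v$), and $W(P_{u,v})$ is the product of the weights of the edges of $P_{u,v}$ (equal to $1$ if $u=v$). For an index set (or vertex set of a subgraph) $U$, $A-U$ is the matrix obtained from $A$ by deleting rows and columns indexed by $U$. $\phi(B,\lambda)=\det(\lambda \mathbb{I}-B)$ is the characteristic polynomial evaluated at $\lambda$, with $\phi$ of the empty matrix equal to $1$. -}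

module Defs where

open import Algebra.Bundles using (CommutativeRing)
open import Data.Fin.Base using (Fin; zero; suc; toℕ; punchIn)
import Data.Fin.Properties as Fin
open import Data.List.Base using (List; []; _∷_; allFin; filter; length; lookup)
open import Data.List.Membership.DecPropositional using (_∈?_)
open import Data.List.Relation.Unary.Unique.Propositional using (Unique)
open import Data.Nat.Base as ℕ using (ℕ; zero; suc; _⊔_)
import Data.Nat.Properties as ℕ
open import Data.Product.Base using (_×_; _,_; ∃)
open import Data.Rational.Base as ℚ using (ℚ; 0ℚ; 1ℚ; ½)
import Data.Rational.Properties as ℚ
open import Data.Rational.Solver using (module +-*-Solver)
open import Data.Vec.Functional using (Vector)
open import Level using (0ℓ)
open import Relation.Binary.PropositionalEquality
  using (_≡_; _≢_; refl; sym; trans; cong; cong₂; subst)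
open import Relation.Nullary using (¬_; ¬?)

-- The real numbers as Cauchy sequences of rationals.

module Reals where

  IsCauchy : (ℕ → ℚ) → Set
  IsCauchy s = ∀ ε → 0ℚ ℚ.< ε → ∃ λ N → ∀ m n → N ℕ.≤ m → N ℕ.≤ n →
               ℚ.∣ s m ℚ.- s n ∣ ℚ.< ε

  -- Without η, the type checker compares x + y and x′ + y′ by their arguments
  -- instead of unfolding rational arithmetic.
  record ℝ : Set where
    no-eta-equality
    constructor mkℝ
    field
      seq    : ℕ → ℚ
      cauchy : IsCauchy seq
  open ℝ public

  infix 4 _≈_

  -- A record rather than a plain Π-type, so that x and y can be inferred.
  record _≈_ (x y : ℝ) : Set where
    no-eta-equality
    constructor mk≈
    field
      close : ∀ ε → 0ℚ ℚ.< ε → ∃ λ N → ∀ n → N ℕ.≤ n →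
              ℚ.∣ seq x n ℚ.- seq y n ∣ ℚ.< ε
  open _≈_ public

  private
    open +-*-Solver

    ½ε : ∀ {ε} → 0ℚ ℚ.< ε → 0ℚ ℚ.< ½ ℚ.* ε
    ½ε 0<ε = ℚ.*-monoʳ-<-pos ½ 0<ε

    halves : ∀ ε → ½ ℚ.* ε ℚ.+ ½ ℚ.* ε ≡ ε
    halves ε = trans (sym (ℚ.*-distribʳ-+ ε ½ ½)) (ℚ.*-identityˡ ε)

    add-close : ∀ a b {ε} → ℚ.∣ a ∣ ℚ.< ½ ℚ.* ε → ℚ.∣ b ∣ ℚ.< ½ ℚ.* ε →
                ℚ.∣ a ℚ.+ b ∣ ℚ.< ε
    add-close a b {ε} p q = subst (ℚ.∣ a ℚ.+ b ∣ ℚ.<_) (halves ε)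
      (ℚ.≤-<-trans (ℚ.∣p+q∣≤∣p∣+∣q∣ a b) (ℚ.+-mono-< p q))

    -‿swap : ∀ a b → ℚ.∣ a ℚ.- b ∣ ≡ ℚ.∣ b ℚ.- a ∣
    -‿swap a b = trans (sym (ℚ.∣-p∣≡∣p∣ (a ℚ.- b)))
      (cong ℚ.∣_∣ (solve 2 (λ a b → :- (a :- b) := b :- a) refl a b))

    split : ∀ {B ε} → 0ℚ ℚ.< B → 0ℚ ℚ.< ε → ∃ λ δ → 0ℚ ℚ.< δ × B ℚ.* δ ≡ ε
    split {B} {ε} 0<B 0<ε = ℚ.1/ B ℚ.* ε , pos , eq
      where
      instance
        B⁺ : ℚ.Positive B
        B⁺ = ℚ.positive 0<B
        B≢0 : ℚ.NonZero B
        B≢0 = ℚ.pos⇒nonZero B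
        B⁻¹⁺ : ℚ.Positive (ℚ.1/ B)
        B⁻¹⁺ = ℚ.1/pos⇒pos B
      pos : 0ℚ ℚ.< ℚ.1/ B ℚ.* ε
      pos = subst (ℚ._< ℚ.1/ B ℚ.* ε) (ℚ.*-zeroʳ (ℚ.1/ B)) (ℚ.*-monoʳ-<-pos (ℚ.1/ B) 0<ε)
      eq : B ℚ.* (ℚ.1/ B ℚ.* ε) ≡ ε
      eq = trans (sym (ℚ.*-assoc B (ℚ.1/ B) ε))
             (trans (cong (ℚ._* ε) (ℚ.*-inverseʳ B)) (ℚ.*-identityˡ ε))

    prod-close : ∀ a b {B δ ε} → 0ℚ ℚ.< B → B ℚ.* δ ≡ ε →
                 ℚ.∣ a ∣ ℚ.≤ B → ℚ.∣ b ∣ ℚ.< δ → ℚ.∣ a ℚ.* b ∣ ℚ.< ε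
    prod-close a b {B} {δ} 0<B eq p q = subst (ℚ.∣ a ℚ.* b ∣ ℚ.<_) eq
      (subst (ℚ._< B ℚ.* δ) (sym (ℚ.∣p*q∣≡∣p∣*∣q∣ a b))
        (ℚ.≤-<-trans
          (ℚ.*-monoʳ-≤-nonNeg ℚ.∣ b ∣ {{ℚ.nonNegative (ℚ.0≤∣p∣ b)}} p)
          (ℚ.*-monoʳ-<-pos B {{ℚ.positive 0<B}} q)))

    0<1 : 0ℚ ℚ.< 1ℚ
    0<1 = ℚ.positive⁻¹ 1ℚ

    bound : ∀ x → ∃ λ B → 0ℚ ℚ.< B × ∃ λ N → ∀ n → N ℕ.≤ n → ℚ.∣ seq x n ∣ ℚ.≤ B
    bound x with cauchy x 1ℚ 0<1
    ... | N , f = 1ℚ ℚ.+ ℚ.∣ seq x N ∣ , ℚ.+-mono-<-≤ 0<1 (ℚ.0≤∣p∣ (seq x N)) , N , λ n N≤n →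
      ℚ.≤-trans
        (ℚ.≤-reflexive (cong ℚ.∣_∣
          (solve 2 (λ a b → a := (a :- b) :+ b) refl (seq x n) (seq x N))))
        (ℚ.≤-trans (ℚ.∣p+q∣≤∣p∣+∣q∣ (seq x n ℚ.- seq x N) (seq x N))
          (ℚ.+-monoˡ-≤ ℚ.∣ seq x N ∣ (ℚ.<⇒≤ (f n N N≤n ℕ.≤-refl))))

    left : ∀ M N {n} → M ⊔ N ℕ.≤ n → M ℕ.≤ n
    left M N = ℕ.m⊔n≤o⇒m≤o M N

    right : ∀ M N {n} → M ⊔ N ℕ.≤ n → N ℕ.≤ n
    right M N = ℕ.m⊔n≤o⇒n≤o M N

    split⁴ : ∀ K L M N {n} → (K ⊔ L) ⊔ (M ⊔ N) ℕ.≤ n →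
             K ℕ.≤ n × L ℕ.≤ n × M ℕ.≤ n × N ℕ.≤ n
    split⁴ K L M N p = left K L kl , right K L kl , left M N mn , right M N mn
      where
      kl = left (K ⊔ L) (M ⊔ N) p
      mn = right (K ⊔ L) (M ⊔ N) p

    sum-diff : ∀ a b c d → (a ℚ.+ b) ℚ.- (c ℚ.+ d) ≡ (a ℚ.- c) ℚ.+ (b ℚ.- d)
    sum-diff = solve 4 (λ a b c d → (a :+ b) :- (c :+ d) := (a :- c) :+ (b :- d)) refl

    prod-diff : ∀ a b c d → (a ℚ.* b) ℚ.- (c ℚ.* d) ≡ a ℚ.* (b ℚ.- d) ℚ.+ d ℚ.* (a ℚ.- c)
    prod-diff = solve 4 (λ a b c d → (a :* b) :- (c :* d) := a :* (b :- d) :+ d :* (a :- c)) refl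

    neg-diff : ∀ a b → (ℚ.- a) ℚ.- (ℚ.- b) ≡ b ℚ.- a
    neg-diff = solve 2 (λ a b → (:- a) :- (:- b) := b :- a) refl

    rewrite-close : ∀ {a b ε} → a ≡ b → ℚ.∣ b ∣ ℚ.< ε → ℚ.∣ a ∣ ℚ.< ε
    rewrite-close refl p = p

    prod-tol : ∀ {B C ε} → 0ℚ ℚ.< B → 0ℚ ℚ.< C → 0ℚ ℚ.< ε →
      ∃ λ δ → ∃ λ γ → 0ℚ ℚ.< δ × 0ℚ ℚ.< γ ×
      (∀ a b c d → ℚ.∣ a ∣ ℚ.≤ B → ℚ.∣ d ∣ ℚ.≤ C → ℚ.∣ b ℚ.- d ∣ ℚ.< δ →
       ℚ.∣ a ℚ.- c ∣ ℚ.< γ → ℚ.∣ a ℚ.* b ℚ.- c ℚ.* d ∣ ℚ.< ε)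
    prod-tol 0<B 0<C 0<ε =
      let δ , 0<δ , Bδ = split 0<B (½ε 0<ε)
          γ , 0<γ , Cγ = split 0<C (½ε 0<ε)
      in δ , γ , 0<δ , 0<γ , λ a b c d ∣a∣≤B ∣d∣≤C p q →
        rewrite-close (prod-diff a b c d)
          (add-close (a ℚ.* (b ℚ.- d)) (d ℚ.* (a ℚ.- c))
            (prod-close a (b ℚ.- d) 0<B Bδ ∣a∣≤B p)
            (prod-close d (a ℚ.- c) 0<C Cγ ∣d∣≤C q))

  infixl 6 _+_
  infixl 7 _*_
  infix  8 -_

  _+_ : ℝ → ℝ → ℝ
  seq (x + y) n = seq x n ℚ.+ seq y n
  cauchy (x + y) ε 0<ε =
    let M , f = cauchy x _ (½ε 0<ε)
        N , g = cauchy y _ (½ε 0<ε)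
    in M ⊔ N , λ m n p q →
      rewrite-close (sum-diff (seq x m) (seq y m) (seq x n) (seq y n))
        (add-close (seq x m ℚ.- seq x n) _ (f m n (left M N p) (left M N q)) (g m n (right M N p) (right M N q)))

  -_ : ℝ → ℝ
  seq (- x) n = ℚ.- seq x n
  cauchy (- x) ε 0<ε =
    let N , f = cauchy x ε 0<ε
    in N , λ m n p q → rewrite-close (neg-diff (seq x m) (seq x n)) (f n m q p)

  _*_ : ℝ → ℝ → ℝ
  seq (x * y) n = seq x n ℚ.* seq y n
  cauchy (x * y) ε 0<ε =
    let B , 0<B , K , bx = bound x
        C , 0<C , L , by = bound y
        δ , γ , 0<δ , 0<γ , tol = prod-tol 0<B 0<C 0<ε
        M , f = cauchy x γ 0<γ
        N , g = cauchy y δ 0<δ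
    in (K ⊔ L) ⊔ (M ⊔ N) , λ m n p q →
      let K≤m , L≤m , M≤m , N≤m = split⁴ K L M N p
          K≤n , L≤n , M≤n , N≤n = split⁴ K L M N q
      in tol (seq x m) (seq y m) (seq x n) (seq y n)
           (bx m K≤m) (by n L≤n) (g m n N≤m N≤n) (f m n M≤m M≤n)

  private
    ∣a-a∣<ε : ∀ a {ε} → 0ℚ ℚ.< ε → ℚ.∣ a ℚ.- a ∣ ℚ.< ε
    ∣a-a∣<ε a 0<ε = rewrite-close (ℚ.+-inverseʳ a) 0<ε

  fromℚ : ℚ → ℝ
  seq (fromℚ q) _ = q
  cauchy (fromℚ q) ε 0<ε = 0 , λ _ _ _ _ → ∣a-a∣<ε q 0<ε

  private
    pointwise : ∀ {x y} → (∀ n → seq x n ≡ seq y n) → x ≈ y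
    close (pointwise {x} {y} eq) ε 0<ε = 0 , λ n _ →
      subst (λ a → ℚ.∣ a ℚ.- seq y n ∣ ℚ.< ε) (sym (eq n)) (∣a-a∣<ε (seq y n) 0<ε)

    ≈-sym : ∀ {x y} → x ≈ y → y ≈ x
    close (≈-sym {x} {y} p) ε 0<ε =
      let N , f = close p ε 0<ε
      in N , λ n N≤n → subst (ℚ._< ε) (-‿swap (seq x n) (seq y n)) (f n N≤n)

    ≈-trans : ∀ {x y z} → x ≈ y → y ≈ z → x ≈ z
    close (≈-trans {x} {y} {z} p q) ε 0<ε =
      let M , f = close p _ (½ε 0<ε)
          N , g = close q _ (½ε 0<ε)
      in M ⊔ N , λ n h →
        rewrite-close
          (solve 3 (λ a b c → a :- c := (a :- b) :+ (b :- c)) refl (seq x n) (seq y n) (seq z n))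
          (add-close (seq x n ℚ.- seq y n) _ (f n (left M N h)) (g n (right M N h)))

    +-cong : ∀ {x x′ y y′} → x ≈ x′ → y ≈ y′ → x + y ≈ x′ + y′
    close (+-cong {x} {x′} {y} {y′} p q) ε 0<ε =
      let M , f = close p _ (½ε 0<ε)
          N , g = close q _ (½ε 0<ε)
      in M ⊔ N , λ n h →
        rewrite-close (sum-diff (seq x n) (seq y n) (seq x′ n) (seq y′ n))
          (add-close (seq x n ℚ.- seq x′ n) _ (f n (left M N h)) (g n (right M N h)))

    -‿cong : ∀ {x y} → x ≈ y → - x ≈ - y
    close (-‿cong {x} {y} p) ε 0<ε =
      let N , f = close p ε 0<ε
      in N , λ n h →
        rewrite-close (neg-diff (seq x n) (seq y n))
          (subst (ℚ._< ε) (-‿swap (seq x n) (seq y n)) (f n h))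

    *-cong : ∀ {x x′ y y′} → x ≈ x′ → y ≈ y′ → x * y ≈ x′ * y′
    close (*-cong {x} {x′} {y} {y′} p q) ε 0<ε =
      let B , 0<B , K , bx = bound x
          C , 0<C , L , by = bound y′
          δ , γ , 0<δ , 0<γ , tol = prod-tol 0<B 0<C 0<ε
          M , f = close p γ 0<γ
          N , g = close q δ 0<δ
      in (K ⊔ L) ⊔ (M ⊔ N) , λ n h →
        let K≤n , L≤n , M≤n , N≤n = split⁴ K L M N h
        in tol (seq x n) (seq y n) (seq x′ n) (seq y′ n)
             (bx n K≤n) (by n L≤n) (g n N≤n) (f n M≤n)

  ℝ-commutativeRing : CommutativeRing 0ℓ 0ℓ
  ℝ-commutativeRing = record
    { Carrier = ℝ
    ; _≈_ = _≈_
    ; _+_ = _+_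
    ; _*_ = _*_
    ; -_  = -_
    ; 0#  = fromℚ 0ℚ
    ; 1#  = fromℚ 1ℚ
    ; isCommutativeRing = record
      { isRing = record
        { +-isAbelianGroup = record
          { isGroup = record
            { isMonoid = record
              { isSemigroup = record
                { isMagma = record
                  { isEquivalence = record
                    { refl  = pointwise λ _ → refl
                    ; sym   = ≈-sym
                    ; trans = ≈-trans
                    }
                  ; ∙-cong = +-cong
                  }
                ; assoc = λ x y z → pointwise λ n → ℚ.+-assoc (seq x n) (seq y n) (seq z n)
                }
              ; identity = (λ x → pointwise λ n → ℚ.+-identityˡ (seq x n))
                         , (λ x → pointwise λ n → ℚ.+-identityʳ (seq x n))
              }
            ; inverse = (λ x → pointwise λ n → ℚ.+-inverseˡ (seq x n))
                      , (λ x → pointwise λ n → ℚ.+-inverseʳ (seq x n))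
            ; ⁻¹-cong = -‿cong
            }
          ; comm = λ x y → pointwise λ n → ℚ.+-comm (seq x n) (seq y n)
          }
        ; *-cong = *-cong
        ; *-assoc = λ x y z → pointwise λ n → ℚ.*-assoc (seq x n) (seq y n) (seq z n)
        ; *-identity = (λ x → pointwise λ n → ℚ.*-identityˡ (seq x n))
                     , (λ x → pointwise λ n → ℚ.*-identityʳ (seq x n))
        ; distrib = (λ x y z → pointwise λ n → ℚ.*-distribˡ-+ (seq x n) (seq y n) (seq z n))
                  , (λ x y z → pointwise λ n → ℚ.*-distribʳ-+ (seq x n) (seq y n) (seq z n))
        }
      ; *-comm = λ x y → pointwise λ n → ℚ.*-comm (seq x n) (seq y n)
      }
    }

module Matrices {c ℓ} (R : CommutativeRing c ℓ) where

  open CommutativeRing R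
    using (Carrier; _≈_; _+_; _*_; -_; _-_; 0#; 1#; +-rawMonoid; semiring)
  open import Algebra.Definitions.RawMonoid +-rawMonoid using (sum)
  open import Algebra.Properties.Semiring.Exp semiring using (_^_)
  open import Relation.Binary.Construct.Closure.ReflexiveTransitive using (Star; ε; _◅_)

  Matrix : ℕ → Set c
  Matrix n = Fin n → Fin n → Carrier

  Symmetric : ∀ {n} → Matrix n → Set ℓ
  Symmetric A = ∀ u v → A u v ≈ A v u

  1ₘ : ∀ {n} → Matrix n
  1ₘ zero    zero    = 1#
  1ₘ zero    (suc _) = 0#
  1ₘ (suc _) zero    = 0#
  1ₘ (suc i) (suc j) = 1ₘ i j

  -- Laplace expansion along the first row.
  det : ∀ {n} → Matrix n → Carrier
  det {zero}  M = 1#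
  det {suc n} M =
    sum λ j → (- 1#) ^ toℕ j * (M zero j * det λ i k → M (suc i) (punchIn j k))

  φ : ∀ {n} → Matrix n → Carrier → Carrier
  φ B x = det λ i j → x * 1ₘ i j - B i j

  remaining : ∀ {n} → List (Fin n) → List (Fin n)
  remaining {n} U = filter (λ v → ¬? (_∈?_ Fin._≟_ v U)) (allFin n)

  infixl 6 _∖_

  -- The matrix A − U; its rows and columns keep their original order.
  _∖_ : ∀ {n} → Matrix n → (U : List (Fin n)) → Matrix (length (remaining U))
  (A ∖ U) i j = A (lookup (remaining U) i) (lookup (remaining U) j)

  Adj : ∀ {n} → Matrix n → Fin n → Fin n → Set ℓ
  Adj A u v = u ≢ v × ¬ (A u v ≈ 0#)

  vertices : ∀ {n} {A : Matrix n} {u v} → Star (Adj A) u v → List (Fin n)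
  vertices {u = u} ε       = u ∷ []
  vertices {u = u} (_ ◅ p) = u ∷ vertices p

  record Path {n} (A : Matrix n) (u v : Fin n) : Set ℓ where
    constructor path
    field
      walk   : Star (Adj A) u v
      simple : Unique (vertices walk)

    support : List (Fin n)
    support = vertices walk
  open Path public using (support)

  -- A cycle is a path on at least three vertices whose ends are adjacent.
  Acyclic : ∀ {n} → Matrix n → Set ℓ
  Acyclic A = ∀ {u v} (P : Path A u v) → 3 ℕ.≤ length (support P) → ¬ Adj A v u

  edgeProduct : ∀ {n} {A : Matrix n} {u v} → Star (Adj A) u v → Carrier
  edgeProduct                 ε                 = 1#
  edgeProduct {A = A} {u = u} (_◅_ {j = w} _ p) = A u w * edgeProduct p

  W : ∀ {n} {A : Matrix n} {u v} → Path A u v → Carrier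
  W P = edgeProduct (Path.walk P)

  IsEigenvector : ∀ {n} → Matrix n → Carrier → Vector Carrier n → Set ℓ
  IsEigenvector A θ x =
    (∀ v → sum (λ w → A v w * x w) ≈ θ * x v) × ¬ (∀ v → x v ≈ 0#)

  IsEigenvalue : ∀ {n} → Matrix n → Carrier → Set _
  IsEigenvalue A θ = ∃ λ x → IsEigenvector A θ x

  -- Existence of a path is not decidable in general, so the definition of α
  -- by cases is given by its two defining clauses.  In a forest P ranges over
  -- the at most one path from u to v.
  record IsPathVector {n} (A : Matrix n) (θ : Carrier) (u : Fin n)
                      (α : Vector Carrier n) : Set ℓ where
    field
      connected    : ∀ {v} (P : Path A u v) → α v ≈ W P * φ (A ∖ support P) θ
      disconnected : ∀ {v} → ¬ Path A u v → α v ≈ 0#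

open Reals public using (ℝ; ℝ-commutativeRing)
open CommutativeRing ℝ-commutativeRing public using (_≈_; _+_; _*_; _-_; 0#)
open import Algebra.Properties.Semiring.Exp (CommutativeRing.semiring ℝ-commutativeRing) public
  using (_^_)
open Matrices ℝ-commutativeRing public

-- The list of coefficients starts with the constant term.
evalPoly : List ℝ → ℝ → ℝ
evalPoly []       x = 0#
evalPoly (a ∷ as) x = a + x * evalPoly as x

-- Multiplicity as a root of the characteristic polynomial.  Polynomials over ℝ
-- are determined by their values, so φ(A,x) = (x − θ)ᵐ q(x) is stated pointwise.
HasMultiplicity : ∀ {n} → Matrix n → ℝ → ℕ → Set
HasMultiplicity A θ m =
  ∃ λ q → (∀ x → φ A x ≈ (x - θ) ^ m * evalPoly q x) × ¬ (evalPoly q θ ≈ 0#)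

{-# OPTIONS --safe #-}

-- Let C = θI − A and let P be the path from u to v.  The entries α(w) with w
-- adjacent to v belong to the last but one vertex of P, where α uses A − (P ∖ v),
-- or to extensions of P, where α uses A − P − w.  So (Aα)(v) = θ α(v) is W(P)
-- times the vertex recurrence
--   φ(B) = (θ − A_vv) φ(B − v) − Σ_w A_vw² φ(B − v − w),   B = A − (P ∖ v),
-- except that for v = u the term φ(B) is missing; it is φ(A, θ) = 0.
--
-- The recurrence follows by expanding det C along the row of v, then along the
-- row of the chosen column w, and so on: the rows visited form a simple path,
-- and column v can be used only right after w, because later it would close a
-- cycle.
--
-- Equality of Cauchy reals is stable under double negation, so in proving an
-- equation one may decide whether an entry vanishes or a path exists.

module Submission where

open import Algebra.Bundles using (CommutativeMonoid; CommutativeRing)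
import Algebra.Properties.Group as GroupProperties
open import Data.Fin.Base using (Fin; zero; suc; toℕ; punchIn)
import Data.Fin.Properties as Fin
open import Data.List.Base using (List; []; _∷_; _++_; [_]; tabulate; allFin; filter; length; lookup)
open import Data.List.Membership.DecPropositional using () renaming (_∈?_ to member?)
open import Data.List.Membership.Propositional using (_∈_; _∉_)
open import Data.List.Membership.Propositional.Properties
  using (∈-++⁺ˡ; ∈-++⁺ʳ; ∈-++⁻; ∈-filter⁺; ∈-filter⁻; ∈-∃++; ∈-allFin; ∈-lookup)
open import Data.List.Membership.Propositional.Properties.WithK using (unique∧set⇒bag)
open import Data.List.Properties
  using (filter-++; filter-accept; filter-reject; filter-all; length-++; length-++-sucʳ;
         tabulate-lookup; ++-assoc)
open import Data.List.Relation.Binary.BagAndSetEquality using (∼bag⇒↭)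
open import Data.List.Relation.Binary.Permutation.Propositional as ↭ using (_↭_; ↭⇒↭ₛ)
open import Data.List.Relation.Binary.Permutation.Propositional.Properties using (shift)
import Data.List.Relation.Binary.Permutation.Setoid.Properties as Permutationₛ
open import Data.List.Relation.Unary.All as All using ([]; _∷_)
import Data.List.Relation.Unary.All.Properties as All
open import Data.List.Relation.Unary.AllPairs as AllPairs using ([]; _∷_)
open import Data.List.Relation.Unary.Any using (here; there)
open import Data.List.Relation.Unary.Unique.Propositional using (Unique)
open import Data.List.Relation.Unary.Unique.Propositional.Properties
  using (allFin⁺; filter⁺) renaming (++⁺ to unique-++⁺)
open import Data.Nat.Base using (ℕ; zero; suc; z≤n; s≤s) renaming (_≤_ to _≤ₙ_; _⊔_ to _⊔ₙ_)
import Data.Nat.Properties as ℕ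
open import Data.Product.Base using (_×_; _,_; ∃; ∃₂; proj₁; proj₂)
open import Data.Rational.Base as ℚ using (ℚ; 0ℚ; ½)
import Data.Rational.Properties as ℚ
open import Data.Sum.Base using ([_,_]′)
open import Data.Vec.Functional using (Vector)
open import Function.Base using (_∘_; id)
open import Function.Bundles using (mk⇔)
open import Level using (Level; _⊔_)
open import Relation.Binary.Construct.Closure.ReflexiveTransitive using (Star; ε; _◅_; _◅◅_)
open import Relation.Binary.PropositionalEquality using (_≡_; _≢_)
import Relation.Binary.PropositionalEquality as ≡
open import Relation.Nullary using (¬_; Dec; yes; no; ¬?; contradiction; Stable)
open import Relation.Unary using (Pred; Decidable)
open import Defs using (module Matrices; module Reals)

private variable
  a p q s : Level
  X : Set a
  n : ℕ

-- Rearrangements of differences in a commutative ring.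

module RingLemmas {c ℓ} (R : CommutativeRing c ℓ) where

  open CommutativeRing R hiding (zero)
  open import Algebra.Properties.Ring ring public
  open import Algebra.Properties.CommutativeSemigroup
    (CommutativeMonoid.commutativeSemigroup +-commutativeMonoid) public
    using () renaming (interchange to +-interchange)
  open import Relation.Binary.Reasoning.Setoid setoid

  x-0≈x : ∀ x → x - 0# ≈ x
  x-0≈x x = trans (+-congˡ -0#≈0#) (+-identityʳ x)

  -‿cong₂ : ∀ {x x′ y y′} → x ≈ x′ → y ≈ y′ → x - y ≈ x′ - y′
  -‿cong₂ p q = +-cong p (-‿cong q)

  difference-interchange : ∀ w x y z → (w - x) - (y - z) ≈ (w - y) - (x - z)
  difference-interchange w x y z = begin
    (w - x) - (y - z)          ≈⟨ +-congˡ (-‿+-comm y (- z)) ⟨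
    (w - x) + (- y + - (- z))  ≈⟨ +-interchange w (- x) (- y) (- (- z)) ⟩
    (w - y) + (- x + - (- z))  ≈⟨ +-congˡ (-‿+-comm x (- z)) ⟩
    (w - y) - (x - z)          ∎

  -- The shape shared by exchanging two contractions and by exchanging two columns: `x` and `y` are
  -- the terms that use a leading column, `z` and `w` those that use none.
  antisymmetric-terms : ∀ x y {z w} → z ≈ - w → x - (y - z) ≈ - (y - (x - w))
  antisymmetric-terms x y {z} {w} z≈-w = begin
    x - (y - z)      ≈⟨ +-congˡ (⁻¹-anti-homo‿- y z) ⟩
    x + (z - y)      ≈⟨ +-assoc x z (- y) ⟨
    (x + z) - y      ≈⟨ +-congʳ (+-congˡ z≈-w) ⟩
    (x - w) - y      ≈⟨ ⁻¹-anti-homo‿- y (x - w) ⟨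
    - (y - (x - w))  ∎

-- Alternating functions of lists and Laplace expansion along a row.

module LaplaceExpansion {c ℓ} (R : CommutativeRing c ℓ) where

  open CommutativeRing R hiding (zero)
  open RingLemmas R
  open import Relation.Binary.Reasoning.Setoid setoid

  -- The contraction of the wedge c₁ ∧ … ∧ cₘ by f, followed by K.
  expand : (X → Carrier) → List X → (List X → Carrier) → Carrier
  expand f []       K = 0#
  expand f (c ∷ cs) K = f c * K cs - expand f cs (K ∘ (c ∷_))

  expand-cong : ∀ (f : X → Carrier) cs {K L} → (∀ ds → K ds ≈ L ds) →
                expand f cs K ≈ expand f cs L
  expand-cong f []       K≈L = refl
  expand-cong f (c ∷ cs) K≈L =
    -‿cong₂ (*-congˡ (K≈L cs)) (expand-cong f cs (K≈L ∘ (c ∷_)))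

  expand-neg : ∀ (f : X → Carrier) cs K → expand f cs (-_ ∘ K) ≈ - expand f cs K
  expand-neg f []       K = sym -0#≈0#
  expand-neg f (c ∷ cs) K = begin
    f c * (- K cs) - expand f cs (-_ ∘ K ∘ (c ∷_))
      ≈⟨ -‿cong₂ (sym (-‿distribʳ-* _ _)) (expand-neg f cs (K ∘ (c ∷_))) ⟩
    - (f c * K cs) - (- expand f cs (K ∘ (c ∷_)))  ≈⟨ -‿+-comm _ _ ⟩
    - (f c * K cs - expand f cs (K ∘ (c ∷_)))      ∎

  -- An inner expansion along `c ∷ ds` unfolds to a multiple of `K ds` minus a remainder; this form
  -- lets the outer expansion pass through it.
  expand-linear : ∀ (f : X → Carrier) cs x K L →
    expand f cs (λ ds → x * K ds - L ds) ≈ x * expand f cs K - expand f cs L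
  expand-linear f [] x K L = begin
    0#           ≈⟨ zeroʳ x ⟨
    x * 0#       ≈⟨ x-0≈x (x * 0#) ⟨
    x * 0# - 0#  ∎
  expand-linear f (c ∷ cs) x K L = begin
    f c * (x * K cs - L cs) - expand f cs (λ ds → x * K (c ∷ ds) - L (c ∷ ds))
      ≈⟨ -‿cong₂ head (expand-linear f cs x (K ∘ (c ∷_)) (L ∘ (c ∷_))) ⟩
    (x * (f c * K cs) - f c * L cs) - (x * expand f cs (K ∘ (c ∷_)) - expand f cs (L ∘ (c ∷_)))
      ≈⟨ difference-interchange _ _ _ _ ⟩
    (x * (f c * K cs) - x * expand f cs (K ∘ (c ∷_))) - (f c * L cs - expand f cs (L ∘ (c ∷_)))
      ≈⟨ +-congʳ (x[y-z]≈xy-xz _ _ _) ⟨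
    x * (f c * K cs - expand f cs (K ∘ (c ∷_))) - (f c * L cs - expand f cs (L ∘ (c ∷_)))
      ∎
    where
    open import Algebra.Properties.CommutativeSemigroup
      (CommutativeMonoid.commutativeSemigroup *-commutativeMonoid) using (x∙yz≈y∙xz)
    head : f c * (x * K cs - L cs) ≈ x * (f c * K cs) - f c * L cs
    head = trans (x[y-z]≈xy-xz _ _ _) (+-congʳ (x∙yz≈y∙xz _ _ _))

  -- By induction on the columns: the terms where `f` or `g` takes the head column trade places with
  -- opposite signs, and the terms where neither does are the induction hypothesis with `c` absorbed
  -- into `K`.
  expand-anticomm : ∀ (f g : X → Carrier) cs K →
    expand f cs (λ ds → expand g ds K) ≈ - expand g cs (λ ds → expand f ds K)
  expand-anticomm f g []       K = sym -0#≈0#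
  expand-anticomm f g (c ∷ cs) K = begin
    f c * expand g cs K - expand f cs (λ ds → g c * K ds - expand g ds (K ∘ (c ∷_)))
      ≈⟨ +-congˡ (-‿cong (expand-linear f cs (g c) K _)) ⟩
    f c * expand g cs K - (g c * expand f cs K - expand f cs (λ ds → expand g ds (K ∘ (c ∷_))))
      ≈⟨ antisymmetric-terms _ _ (expand-anticomm f g cs (K ∘ (c ∷_))) ⟩
    - (g c * expand f cs K - (f c * expand g cs K - expand g cs (λ ds → expand f ds (K ∘ (c ∷_)))))
      ≈⟨ -‿cong (+-congˡ (-‿cong (expand-linear g cs (f c) K _))) ⟨
    - (g c * expand f cs K - expand g cs (λ ds → f c * K ds - expand f ds (K ∘ (c ∷_))))
      ∎

  Alternating : {X : Set a} → (List X → Carrier) → Set (a ⊔ ℓ)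
  Alternating K = ∀ xs x y ys → K (xs ++ x ∷ y ∷ ys) ≈ - K (xs ++ y ∷ x ∷ ys)

  expand-alternating : ∀ (f : X → Carrier) {K} → Alternating K →
                       Alternating (λ cs → expand f cs K)
  expand-alternating f {K} alt [] x y ys = antisymmetric-terms _ _ (begin
    expand f ys (λ ds → K (x ∷ y ∷ ds))    ≈⟨ expand-cong f ys (alt [] x y) ⟩
    expand f ys (λ ds → - K (y ∷ x ∷ ds))  ≈⟨ expand-neg f ys _ ⟩
    - expand f ys (λ ds → K (y ∷ x ∷ ds))  ∎)
  expand-alternating f {K} alt (c ∷ xs) x y ys = begin
    f c * K (xs ++ x ∷ y ∷ ys) - expand f (xs ++ x ∷ y ∷ ys) (K ∘ (c ∷_))
      ≈⟨ -‿cong₂ (trans (*-congˡ (alt xs x y ys)) (sym (-‿distribʳ-* _ _)))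
                 (expand-alternating f (λ zs → alt (c ∷ zs)) xs x y ys) ⟩
    - (f c * K (xs ++ y ∷ x ∷ ys)) - (- expand f (xs ++ y ∷ x ∷ ys) (K ∘ (c ∷_)))
      ≈⟨ -‿+-comm _ _ ⟩
    - (f c * K (xs ++ y ∷ x ∷ ys) - expand f (xs ++ y ∷ x ∷ ys) (K ∘ (c ∷_)))
      ∎

  infixr 8 -1^∣_∣_

  -- The sign is -1 to the power of the length, indexed by the list of entries passed over so that
  -- it computes along with inductions on that list.
  -1^∣_∣_ : List X → Carrier → Carrier
  -1^∣ []     ∣ x = x
  -1^∣ _ ∷ xs ∣ x = - (-1^∣ xs ∣ x)

  sign-cong : ∀ (xs : List X) {x y} → x ≈ y → -1^∣ xs ∣ x ≈ -1^∣ xs ∣ y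
  sign-cong []       p = p
  sign-cong (_ ∷ xs) p = -‿cong (sign-cong xs p)

  sign-neg : ∀ (xs : List X) x → -1^∣ xs ∣ (- x) ≈ - (-1^∣ xs ∣ x)
  sign-neg []       x = refl
  sign-neg (_ ∷ xs) x = -‿cong (sign-neg xs x)

  sign-involutive : ∀ (xs : List X) x → -1^∣ xs ∣ (-1^∣ xs ∣ x) ≈ x
  sign-involutive []       x = refl
  sign-involutive (_ ∷ xs) x = begin
    - (-1^∣ xs ∣ (- (-1^∣ xs ∣ x)))  ≈⟨ -‿cong (sign-neg xs _) ⟩
    - (- (-1^∣ xs ∣ (-1^∣ xs ∣ x)))  ≈⟨ -‿involutive _ ⟩
    -1^∣ xs ∣ (-1^∣ xs ∣ x)          ≈⟨ sign-involutive xs x ⟩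
    x                                ∎

  sign-zero : ∀ (xs : List X) → -1^∣ xs ∣ 0# ≈ 0#
  sign-zero []       = refl
  sign-zero (_ ∷ xs) = trans (-‿cong (sign-zero xs)) -0#≈0#

  *-sign : ∀ (xs : List X) x y → x * (-1^∣ xs ∣ y) ≈ -1^∣ xs ∣ (x * y)
  *-sign []       x y = refl
  *-sign (_ ∷ xs) x y = trans (sym (-‿distribʳ-* _ _)) (-‿cong (*-sign xs x y))

  alternating-move : ∀ (K : List X → Carrier) → Alternating K →
    ∀ xs x ys → K (xs ++ x ∷ ys) ≈ -1^∣ xs ∣ K (x ∷ xs ++ ys)
  alternating-move K alt []       x ys = refl
  alternating-move K alt (z ∷ xs) x ys = begin
    K (z ∷ xs ++ x ∷ ys)              ≈⟨ alternating-move (K ∘ (z ∷_)) (λ zs → alt (z ∷ zs)) xs x ys ⟩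
    -1^∣ xs ∣ K (z ∷ x ∷ xs ++ ys)    ≈⟨ sign-cong xs (alt [] z x (xs ++ ys)) ⟩
    -1^∣ xs ∣ (- K (x ∷ z ∷ xs ++ ys))  ≈⟨ sign-neg xs _ ⟩
    - (-1^∣ xs ∣ K (x ∷ z ∷ xs ++ ys))  ∎

  Σ[_] : List X → (X → Carrier) → Carrier
  Σ[ []     ] g = 0#
  Σ[ x ∷ xs ] g = g x + Σ[ xs ] g

  -- The expansion gives the column after `xs` the sign `-1^∣ xs ∣`, so a summand bearing the same
  -- sign contributes just `g x`. In the applications the second sign comes from moving a row to the
  -- front.
  expand≈Σ : ∀ (f : X → Carrier) cs K g →
    (∀ xs x ys → cs ≡ xs ++ x ∷ ys → f x * K (xs ++ ys) ≈ -1^∣ xs ∣ g x) →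
    expand f cs K ≈ Σ[ cs ] g
  expand≈Σ f []       K g h = refl
  expand≈Σ f (c ∷ cs) K g h = +-cong (h [] c cs ≡.refl) (begin
    - expand f cs (K ∘ (c ∷_))    ≈⟨ expand-neg f cs _ ⟨
    expand f cs (-_ ∘ K ∘ (c ∷_)) ≈⟨ expand≈Σ f cs _ g tail ⟩
    Σ[ cs ] g                     ∎)
    where
    tail : ∀ xs x ys → cs ≡ xs ++ x ∷ ys → f x * (- K (c ∷ xs ++ ys)) ≈ -1^∣ xs ∣ g x
    tail xs x ys eq = begin
      f x * (- K (c ∷ xs ++ ys))  ≈⟨ -‿distribʳ-* _ _ ⟨
      - (f x * K (c ∷ xs ++ ys))  ≈⟨ -‿cong (h (c ∷ xs) x ys (≡.cong (c ∷_) eq)) ⟩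
      - (- (-1^∣ xs ∣ g x))       ≈⟨ -‿involutive _ ⟩
      -1^∣ xs ∣ g x               ∎

-- Minors with listed rows and columns.

module Minors {c ℓ} (R : CommutativeRing c ℓ) {a} {X : Set a}
              (M : X → X → CommutativeRing.Carrier R) where

  open CommutativeRing R hiding (zero)
  open LaplaceExpansion R
  open RingLemmas R
  open Matrices R using (det)
  open import Algebra.Definitions.RawMonoid +-rawMonoid using (sum)
  open import Algebra.Properties.Monoid.Sum +-monoid using (sum-cong-≋)
  open import Algebra.Properties.Semiring.Sum semiring using (*-distribˡ-sum)
  open import Algebra.Properties.Semiring.Exp semiring using (_^_)
  open import Relation.Binary.Reasoning.Setoid setoid

  -- Rows and columns are lists, so that each may be permuted by itself; lists of different lengths
  -- give zero.
  minor : List X → List X → Carrier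
  minor []       []      = 1#
  minor []       (_ ∷ _) = 0#
  minor (r ∷ rs) cs      = expand (M r) cs (minor rs)

  minor-alternatingᶜ : ∀ rs → Alternating (minor rs)
  minor-alternatingᶜ []       []      x y ys = sym -0#≈0#
  minor-alternatingᶜ []       (_ ∷ _) x y ys = sym -0#≈0#
  minor-alternatingᶜ (r ∷ rs) = expand-alternating (M r) (minor-alternatingᶜ rs)

  -- Two adjacent rows are two nested contractions, which anticommute.
  minor-alternatingʳ : ∀ cs → Alternating (λ rs → minor rs cs)
  minor-alternatingʳ cs []       x y ys = expand-anticomm (M x) (M y) cs (minor ys)
  minor-alternatingʳ cs (r ∷ rs) x y ys = begin
    expand (M r) cs (minor (rs ++ x ∷ y ∷ ys))
      ≈⟨ expand-cong (M r) cs (λ ds → minor-alternatingʳ ds rs x y ys) ⟩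
    expand (M r) cs (-_ ∘ minor (rs ++ y ∷ x ∷ ys))
      ≈⟨ expand-neg (M r) cs _ ⟩
    - expand (M r) cs (minor (rs ++ y ∷ x ∷ ys))
      ∎

  minor-moveʳ : ∀ cs xs x ys → minor (xs ++ x ∷ ys) cs ≈ -1^∣ xs ∣ minor (x ∷ xs ++ ys) cs
  minor-moveʳ cs = alternating-move (λ rs → minor rs cs) (minor-alternatingʳ cs)

  -- The row and the column move to the front with the same sign, and the two signs cancel.
  principal-move : ∀ xs x ys →
    minor (xs ++ x ∷ ys) (xs ++ x ∷ ys) ≈ minor (x ∷ xs ++ ys) (x ∷ xs ++ ys)
  principal-move xs x ys = begin
    minor (xs ++ x ∷ ys) (xs ++ x ∷ ys)
      ≈⟨ minor-moveʳ _ xs x ys ⟩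
    -1^∣ xs ∣ minor (x ∷ xs ++ ys) (xs ++ x ∷ ys)
      ≈⟨ sign-cong xs (alternating-move (minor (x ∷ xs ++ ys)) (minor-alternatingᶜ (x ∷ xs ++ ys)) xs x ys) ⟩
    -1^∣ xs ∣ -1^∣ xs ∣ minor (x ∷ xs ++ ys) (x ∷ xs ++ ys)
      ≈⟨ sign-involutive xs _ ⟩
    minor (x ∷ xs ++ ys) (x ∷ xs ++ ys)
      ∎

  -- The powers of -1 for the tail columns share a factor -1, which is the minus sign in the
  -- recursion of `expand`.
  expand-tabulate : ∀ (f : X → Carrier) K {n} (γ : Fin (suc n) → X) →
    sum (λ j → (- 1#) ^ toℕ j * (f (γ j) * K (tabulate (γ ∘ punchIn j)))) ≈
    expand f (tabulate γ) K
  expand-tabulate f K {zero} γ = begin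
    1# * (f (γ zero) * K []) + 0#  ≈⟨ +-identityʳ _ ⟩
    1# * (f (γ zero) * K [])       ≈⟨ *-identityˡ _ ⟩
    f (γ zero) * K []              ≈⟨ x-0≈x _ ⟨
    f (γ zero) * K [] - 0#         ∎
  expand-tabulate f K {suc n} γ = +-cong (*-identityˡ _) (begin
    sum (λ j → (- 1# * (- 1#) ^ toℕ j) * term j)
      ≈⟨ sum-cong-≋ (λ j → *-assoc (- 1#) ((- 1#) ^ toℕ j) (term j)) ⟩
    sum (λ j → - 1# * ((- 1#) ^ toℕ j * term j))
      ≈⟨ *-distribˡ-sum (- 1#) (λ j → (- 1#) ^ toℕ j * term j) ⟨
    - 1# * sum (λ j → (- 1#) ^ toℕ j * term j)
      ≈⟨ -1*x≈-x _ ⟩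
    - sum (λ j → (- 1#) ^ toℕ j * term j)
      ≈⟨ -‿cong (expand-tabulate f (K ∘ (γ zero ∷_)) (γ ∘ suc)) ⟩
    - expand f (tabulate (γ ∘ suc)) (K ∘ (γ zero ∷_))
      ∎)
    where
    term : Fin (suc n) → Carrier
    term j = f (γ (suc j)) * K (γ zero ∷ tabulate (γ ∘ suc ∘ punchIn j))

  -- Arbitrary index maps let the induction compose with `punchIn`, and cover principal submatrices
  -- besides the whole matrix.
  det≈minor : ∀ {n} (ρ γ : Fin n → X) →
    det (λ i j → M (ρ i) (γ j)) ≈ minor (tabulate ρ) (tabulate γ)
  det≈minor {zero}  ρ γ = refl
  det≈minor {suc n} ρ γ = begin
    sum (λ j → (- 1#) ^ toℕ j * (M (ρ zero) (γ j) * det (λ i k → M (ρ (suc i)) (γ (punchIn j k)))))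
      ≈⟨ sum-cong-≋ (λ j → *-congˡ {(- 1#) ^ toℕ j} (*-congˡ {M (ρ zero) (γ j)}
                             (det≈minor (ρ ∘ suc) (γ ∘ punchIn j)))) ⟩
    sum (λ j → (- 1#) ^ toℕ j * (M (ρ zero) (γ j) * minor (tabulate (ρ ∘ suc)) (tabulate (γ ∘ punchIn j))))
      ≈⟨ expand-tabulate (M (ρ zero)) (minor (tabulate (ρ ∘ suc))) γ ⟩
    expand (M (ρ zero)) (tabulate γ) (minor (tabulate (ρ ∘ suc)))
      ∎

-- Lists without repetitions.

filter-filter : ∀ {P : Pred X p} {Q : Pred X q} {S : Pred X s}
  (P? : Decidable P) (Q? : Decidable Q) (S? : Decidable S) →
  (∀ {x} → P x → Q x → S x) → (∀ {x} → S x → P x × Q x) →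
  ∀ xs → filter Q? (filter P? xs) ≡ filter S? xs
filter-filter P? Q? S? to from [] = ≡.refl
filter-filter P? Q? S? to from (x ∷ xs) with P? x
... | no ¬p = ≡.trans (filter-filter P? Q? S? to from xs)
                (≡.sym (filter-reject S? (¬p ∘ proj₁ ∘ from)))
... | yes p with Q? x
...   | no ¬q = ≡.trans (filter-filter P? Q? S? to from xs)
                  (≡.sym (filter-reject S? (¬q ∘ proj₂ ∘ from)))
...   | yes q = ≡.trans (≡.cong (x ∷_) (filter-filter P? Q? S? to from xs))
                  (≡.sym (filter-accept S? (to p q)))

unique-middle : ∀ (xs : List X) {x ys} → Unique (xs ++ x ∷ ys) → Unique (x ∷ xs ++ ys)
unique-middle xs {x} {ys} =
  Permutationₛ.Unique-resp-↭ (≡.setoid _) (↭⇒↭ₛ (shift x xs ys))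

unique-++⁻ˡ : ∀ (xs : List X) {ys} → Unique (xs ++ ys) → Unique xs
unique-++⁻ˡ []       _         = []
unique-++⁻ˡ (x ∷ xs) (x∉ ∷ xs!) = All.++⁻ˡ xs x∉ ∷ unique-++⁻ˡ xs xs!

unique-∷ʳ : ∀ {xs : List X} {x} → Unique xs → x ∉ xs → Unique (xs ++ [ x ])
unique-∷ʳ xs! x∉xs = unique-++⁺ xs! ([] ∷ []) λ { (x∈xs , here ≡.refl) → x∉xs x∈xs }

∉-head : ∀ {x} {xs : List X} → Unique (x ∷ xs) → x ∉ xs
∉-head (x∉ ∷ _) x∈xs = All.lookup x∉ x∈xs ≡.refl

lookup-injective : ∀ {xs : List X} → Unique xs → ∀ i j → lookup xs i ≡ lookup xs j → i ≡ j
lookup-injective (_  ∷ _)   zero    zero    _  = ≡.refl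
lookup-injective (x∉ ∷ _)   zero    (suc j) eq = contradiction eq (All.lookup x∉ (∈-lookup j))
lookup-injective (x∉ ∷ _)   (suc i) zero    eq =
  contradiction (≡.sym eq) (All.lookup x∉ (∈-lookup i))
lookup-injective (_  ∷ xs!) (suc i) (suc j) eq = ≡.cong suc (lookup-injective xs! i j eq)

infix 4 _∈?_

_∈?_ : ∀ (v : Fin n) U → Dec (v ∈ U)
_∈?_ = member? Fin._≟_

without : Fin n → List (Fin n) → List (Fin n)
without v = filter (λ w → ¬? (v Fin.≟ w))

without-middle : ∀ xs (v : Fin n) ys → Unique (xs ++ v ∷ ys) →
                 without v (xs ++ v ∷ ys) ≡ xs ++ ys
without-middle xs v ys xvys! with v∉ ∷ _ ← unique-middle xs xvys! = begin
  filter P? (xs ++ v ∷ ys)          ≡⟨ filter-++ P? xs (v ∷ ys) ⟩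
  filter P? xs ++ filter P? (v ∷ ys) ≡⟨ ≡.cong (filter P? xs ++_) (filter-reject P? (λ v≢v → v≢v ≡.refl)) ⟩
  filter P? xs ++ filter P? ys       ≡⟨ filter-++ P? xs ys ⟨
  filter P? (xs ++ ys)               ≡⟨ filter-all P? v∉ ⟩
  xs ++ ys                           ∎
  where
  open ≡.≡-Reasoning
  P? = λ w → ¬? (v Fin.≟ w)

-- Vertices outside a given set.

module Remaining {c ℓ} (R : CommutativeRing c ℓ) where

  open Matrices R using (remaining)

  ∈-remaining⁺ : ∀ {v : Fin n} {U} → v ∉ U → v ∈ remaining U
  ∈-remaining⁺ {U = U} = ∈-filter⁺ (λ v → ¬? (v ∈? U)) (∈-allFin _)

  ∈-remaining⁻ : ∀ {v : Fin n} U → v ∈ remaining U → v ∉ U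
  ∈-remaining⁻ {n} U v∈ = proj₂ (∈-filter⁻ (λ v → ¬? (v ∈? U)) {xs = allFin n} v∈)

  remaining-unique : ∀ (U : List (Fin n)) → Unique (remaining U)
  remaining-unique {n} U = filter⁺ (λ v → ¬? (v ∈? U)) (allFin⁺ n)

  remaining-[] : remaining [] ≡ allFin n
  remaining-[] = filter-all (λ v → ¬? (v ∈? [])) (All.tabulate λ _ ())

  remaining-∷ʳ : ∀ U (v : Fin n) → remaining (U ++ [ v ]) ≡ without v (remaining U)
  remaining-∷ʳ {n} U v = ≡.sym (filter-filter
    (λ w → ¬? (w ∈? U)) (λ w → ¬? (v Fin.≟ w)) (λ w → ¬? (w ∈? (U ++ [ v ])))
    (λ w∉U v≢w → [ w∉U , (λ { (here w≡v) → v≢w (≡.sym w≡v) }) ]′ ∘ ∈-++⁻ U)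
    (λ w∉ → w∉ ∘ ∈-++⁺ˡ , λ { ≡.refl → w∉ (∈-++⁺ʳ U (here ≡.refl)) })
    (allFin n))

  -- Deleting one more vertex takes a single entry out of the ordered list; the common `xs` and `ys`
  -- are the form that `principal-move` takes.
  remaining-split : ∀ U {v : Fin n} → v ∉ U → ∃₂ λ xs ys →
    remaining U ≡ xs ++ v ∷ ys × remaining (U ++ [ v ]) ≡ xs ++ ys
  remaining-split U {v} v∉U with xs , ys , eq ← ∈-∃++ (∈-remaining⁺ v∉U) =
    xs , ys , eq , (begin
      remaining (U ++ [ v ])       ≡⟨ remaining-∷ʳ U v ⟩
      without v (remaining U)      ≡⟨ ≡.cong (without v) eq ⟩
      without v (xs ++ v ∷ ys)     ≡⟨ without-middle xs v ys (≡.subst Unique eq (remaining-unique U)) ⟩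
      xs ++ ys                     ∎)
    where open ≡.≡-Reasoning

  -- Both lists are free of repetitions and contain every vertex.
  allFin↭ : ∀ {U : List (Fin n)} → Unique U → allFin n ↭ U ++ remaining U
  allFin↭ {n} {U} U! = ∼bag⇒↭ (unique∧set⇒bag (allFin⁺ n)
    (unique-++⁺ U! (remaining-unique U) (λ { (v∈U , v∈) → ∈-remaining⁻ U v∈ v∈U }))
    (λ {v} → mk⇔ (λ _ → split v) (λ _ → ∈-allFin v)))
    where
    split : ∀ v → v ∈ U ++ remaining U
    split v with v ∈? U
    ... | yes v∈U = ∈-++⁺ˡ v∈U
    ... | no  v∉U = ∈-++⁺ʳ U (∈-remaining⁺ v∉U)

-- Walks and simple paths.

module Walks {c ℓ} (R : CommutativeRing c ℓ) {n} {A : Matrices.Matrix R n} where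

  open CommutativeRing R hiding (zero)
  open Matrices R

  -- `Star` exposes the first edge of a walk, whereas the neighbour of `v` on the path from `u` sits
  -- at the last edge.
  data SnocView {u} : ∀ {v} → Star (Adj A) u v → Set (c ⊔ ℓ) where
    nil  : SnocView ε
    snoc : ∀ {w v} (p : Star (Adj A) u w) (e : Adj A w v) → SnocView (p ◅◅ e ◅ ε)

  snocView : ∀ {u v} (p : Star (Adj A) u v) → SnocView p
  snocView ε       = nil
  snocView (e ◅ p) with snocView p
  ... | nil       = snoc ε e
  ... | snoc q e′ = snoc (e ◅ q) e′

  vertices-∷ʳ : ∀ {u v w} (p : Star (Adj A) u v) (e : Adj A v w) →
                vertices (p ◅◅ e ◅ ε) ≡ vertices p ++ [ w ]
  vertices-∷ʳ ε       e = ≡.refl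
  vertices-∷ʳ (_ ◅ p) e = ≡.cong (_ ∷_) (vertices-∷ʳ p e)

  edgeProduct-∷ʳ : ∀ {u v w} (p : Star (Adj A) u v) (e : Adj A v w) →
                   edgeProduct (p ◅◅ e ◅ ε) ≈ edgeProduct p * A v w
  edgeProduct-∷ʳ ε       e = *-comm _ _
  edgeProduct-∷ʳ (_ ◅ p) e = trans (*-congˡ (edgeProduct-∷ʳ p e)) (sym (*-assoc _ _ _))

  target∈vertices : ∀ {u v} (p : Star (Adj A) u v) → v ∈ vertices p
  target∈vertices ε       = here ≡.refl
  target∈vertices (_ ◅ p) = there (target∈vertices p)

  1≤∣vertices∣ : ∀ {u v} (p : Star (Adj A) u v) → 1 ≤ₙ length (vertices p)
  1≤∣vertices∣ ε       = s≤s z≤n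
  1≤∣vertices∣ (_ ◅ p) = s≤s z≤n

  prefix : ∀ {u v w} (p : Star (Adj A) u w) → v ∈ vertices p →
           ∃ λ (q : Star (Adj A) u v) → ∃ λ vs → vertices p ≡ vertices q ++ vs
  prefix ε       (here ≡.refl) = ε , [] , ≡.refl
  prefix (_ ◅ p) (here ≡.refl) = ε , vertices p , ≡.refl
  prefix (e ◅ p) (there v∈p) with q , vs , eq ← prefix p v∈p =
    e ◅ q , vs , ≡.cong (_ ∷_) eq

  -- If `v` already lies on the path, the new edge is dropped and the path is cut at `v`, so the
  -- result is simple either way.
  extend : ∀ {u v w} → Path A u w → Adj A w v → Path A u v
  extend {v = v} (path p p!) e with v ∈? vertices p
  ... | no v∉p = path (p ◅◅ e ◅ ε) (≡.subst Unique (≡.sym (vertices-∷ʳ p e)) (unique-∷ʳ p! v∉p))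
  ... | yes v∈p with q , vs , eq ← prefix p v∈p =
    path q (unique-++⁻ˡ (vertices q) (≡.subst Unique eq p!))

-- Sums over lists.

module ListSums {c ℓ} (R : CommutativeRing c ℓ) where

  open CommutativeRing R hiding (zero)
  open LaplaceExpansion R using (Σ[_])
  open import Algebra.Definitions.RawMonoid +-rawMonoid using (sum)
  open import Algebra.Properties.CommutativeSemigroup
    (CommutativeMonoid.commutativeSemigroup +-commutativeMonoid) using (x∙yz≈y∙xz)

  Σ-cong : ∀ (xs : List X) {g h} → (∀ x → x ∈ xs → g x ≈ h x) → Σ[ xs ] g ≈ Σ[ xs ] h
  Σ-cong []       g≈h = refl
  Σ-cong (x ∷ xs) g≈h = +-cong (g≈h x (here ≡.refl)) (Σ-cong xs (λ y → g≈h y ∘ there))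

  Σ-zero : ∀ (xs : List X) → Σ[ xs ] (λ _ → 0#) ≈ 0#
  Σ-zero []       = refl
  Σ-zero (x ∷ xs) = trans (+-identityˡ _) (Σ-zero xs)

  *-distribˡ-Σ : ∀ (xs : List X) x g → x * Σ[ xs ] g ≈ Σ[ xs ] (λ y → x * g y)
  *-distribˡ-Σ []       x g = zeroʳ x
  *-distribˡ-Σ (_ ∷ xs) x g = trans (distribˡ _ _ _) (+-congˡ (*-distribˡ-Σ xs x g))

  Σ-++ : ∀ (xs : List X) {ys} g → Σ[ xs ++ ys ] g ≈ Σ[ xs ] g + Σ[ ys ] g
  Σ-++ []       g = sym (+-identityˡ _)
  Σ-++ (x ∷ xs) g = trans (+-congˡ (Σ-++ xs g)) (sym (+-assoc _ _ _))

  Σ-↭ : ∀ {xs ys : List X} g → xs ↭ ys → Σ[ xs ] g ≈ Σ[ ys ] g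
  Σ-↭ g ↭.refl          = refl
  Σ-↭ g (↭.prep x p)   = +-congˡ (Σ-↭ g p)
  Σ-↭ g (↭.swap x y p) = trans (+-congˡ (+-congˡ (Σ-↭ g p))) (x∙yz≈y∙xz _ _ _)
  Σ-↭ g (↭.trans p q)   = trans (Σ-↭ g p) (Σ-↭ g q)

  sum≈Σ-tabulate : ∀ {n} (f : Fin n → X) g → sum (g ∘ f) ≈ Σ[ tabulate f ] g
  sum≈Σ-tabulate {n = zero}  f g = refl
  sum≈Σ-tabulate {n = suc n} f g = +-congˡ (sum≈Σ-tabulate (f ∘ suc) g)

-- The characteristic matrix and its principal minors.

module CharacteristicMatrix {c ℓ} (R : CommutativeRing c ℓ) {n}
  (A : Matrices.Matrix R n) (θ : CommutativeRing.Carrier R) where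

  open CommutativeRing R hiding (zero)
  open Matrices R
  open RingLemmas R
  open Remaining R
  open import Algebra.Properties.Monoid.Sum +-monoid using (sum-cong-≋)
  open import Algebra.Properties.Semiring.Exp semiring using (_^_)
  open import Relation.Binary.Reasoning.Setoid setoid

  C : Matrix n
  C i j = θ * 1ₘ i j - A i j

  open Minors R C public

  1ₘ-diagonal : ∀ {m} (i : Fin m) → 1ₘ i i ≈ 1#
  1ₘ-diagonal zero    = refl
  1ₘ-diagonal (suc i) = 1ₘ-diagonal i

  1ₘ-offDiagonal : ∀ {m} {i j : Fin m} → i ≢ j → 1ₘ i j ≈ 0#
  1ₘ-offDiagonal {i = zero}  {zero}  i≢j = contradiction ≡.refl i≢j
  1ₘ-offDiagonal {i = zero}  {suc j} i≢j = refl
  1ₘ-offDiagonal {i = suc i} {zero}  i≢j = refl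
  1ₘ-offDiagonal {i = suc i} {suc j} i≢j = 1ₘ-offDiagonal (i≢j ∘ ≡.cong suc)

  -- Needed because the characteristic polynomial of a submatrix uses the identity matrix of the
  -- smaller size, while minors of `C` use entries of the large one.
  1ₘ-injective : ∀ {m} (f : Fin m → Fin n) → (∀ i j → f i ≡ f j → i ≡ j) →
                 ∀ i j → 1ₘ i j ≈ 1ₘ (f i) (f j)
  1ₘ-injective f f-inj i j with i Fin.≟ j
  ... | yes ≡.refl = trans (1ₘ-diagonal i) (sym (1ₘ-diagonal (f i)))
  ... | no i≢j     = trans (1ₘ-offDiagonal i≢j) (sym (1ₘ-offDiagonal (i≢j ∘ f-inj i j)))

  C-diagonal : ∀ i → C i i ≈ θ - A i i
  C-diagonal i = +-congʳ (trans (*-congˡ (1ₘ-diagonal i)) (*-identityʳ θ))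

  C-offDiagonal : ∀ {i j} → i ≢ j → C i j ≈ - A i j
  C-offDiagonal i≢j = trans
    (+-congʳ (trans (*-congˡ (1ₘ-offDiagonal i≢j)) (zeroʳ θ))) (+-identityˡ _)

  det-cong : ∀ {m} {M N : Matrix m} → (∀ i j → M i j ≈ N i j) → det M ≈ det N
  det-cong {zero}  M≈N = refl
  det-cong {suc m} M≈N = sum-cong-≋ λ j → *-congˡ {(- 1#) ^ toℕ j}
    (*-cong (M≈N zero j) (det-cong λ i k → M≈N (suc i) (punchIn j k)))

  principal : List (Fin n) → Carrier
  principal vs = minor vs vs

  φ≈principal : ∀ U → φ (A ∖ U) θ ≈ principal (remaining U)
  φ≈principal U = begin
    φ (A ∖ U) θ
      ≈⟨ det-cong (λ i j → +-congʳ (*-congˡ {θ}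
           (1ₘ-injective (lookup vs) (lookup-injective (remaining-unique U)) i j))) ⟩
    det (λ i j → C (lookup vs i) (lookup vs j))
      ≈⟨ det≈minor (lookup vs) (lookup vs) ⟩
    principal (tabulate (lookup vs))
      ≡⟨ ≡.cong principal (tabulate-lookup vs) ⟩
    principal vs
      ∎
    where vs = remaining U

  φ≈principal-allFin : φ A θ ≈ principal (allFin n)
  φ≈principal-allFin = det≈minor id id

-- Excluded cycles and the vertex recurrence in a forest.

module Forest {c ℓ} (R : CommutativeRing c ℓ)
  (stable : ∀ x y → Stable (CommutativeRing._≈_ R x y))
  {n} {A : Matrices.Matrix R n}
  (A-sym : Matrices.Symmetric R A) (acyclic : Matrices.Acyclic R A)
  (θ : CommutativeRing.Carrier R) where

  open CommutativeRing R hiding (zero)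
  open Matrices R
  open RingLemmas R
  open LaplaceExpansion R
  open ListSums R
  open Walks R {A = A}
  open Remaining R
  open CharacteristicMatrix R A θ
  open import Algebra.Definitions.RawMonoid +-rawMonoid using (sum)
  open import Algebra.Properties.CommutativeSemigroup
    (CommutativeMonoid.commutativeSemigroup *-commutativeMonoid)
    using (x∙yz≈y∙xz; x∙yz≈yx∙z)
  open import Relation.Binary.Reasoning.Setoid setoid

  -- If `x ≈ y` failed, `yes!` would refute `P`, and then `no!` would prove `x ≈ y`; stability
  -- removes the double negation.
  by-cases : ∀ {p} {P : Set p} {x y} → (P → x ≈ y) → (¬ P → x ≈ y) → x ≈ y
  by-cases yes! no! = stable _ _ λ x≉y → x≉y (no! (x≉y ∘ yes!))

  Adj-sym : ∀ {u v} → Adj A u v → Adj A v u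
  Adj-sym (u≢v , Auv≉0) = u≢v ∘ ≡.sym , Auv≉0 ∘ trans (A-sym _ _)

  nonedge : ∀ {u v} → u ≢ v → A u v ≈ 0# → C u v ≈ 0#
  nonedge u≢v Auv≈0 = trans (C-offDiagonal u≢v) (trans (-‿cong Auv≈0) -0#≈0#)

  -- A nonzero entry would be an edge from `v` back to `u`, closing a cycle on at least three
  -- vertices; stability turns this refutation into an equation.
  closing-edge : ∀ {u w v} (e : Adj A u w) (p : Star (Adj A) w v) →
    2 ≤ₙ length (vertices p) → Unique (u ∷ vertices p) → A v u ≈ 0#
  closing-edge e p 2≤∣p∣ up! = stable _ _ λ Avu≉0 →
    acyclic (path (e ◅ p) up!) (s≤s 2≤∣p∣)
      ((λ { ≡.refl → ∉-head up! (target∈vertices p) }) , Avu≉0)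

  -- Following the row of s and then those of the columns so chosen traces a
  -- simple path that ends at v; column v could only be used to close a cycle.
  tail-vanishes : ∀ k {s v} (p : Star (Adj A) s v) → 2 ≤ₙ length (vertices p) →
    ∀ L → length L ≡ k → Unique (vertices p ++ L) →
    expand (C s) L (λ cs → minor L (v ∷ cs)) ≈ 0#
  tail-vanishes zero            p 2≤∣p∣ [] _     pL! = refl
  tail-vanishes (suc k) {s} {v} p 2≤∣p∣ L ∣L∣≡k pL! =
    trans (expand≈Σ (C s) L _ (λ _ → 0#) term) (Σ-zero L)
    where
    term : ∀ xs x ys → L ≡ xs ++ x ∷ ys →
           C s x * minor L (v ∷ xs ++ ys) ≈ -1^∣ xs ∣ 0#
    term xs x ys ≡.refl = by-cases
      (λ Asx≈0 → begin
        C s x * minor L (v ∷ L′)  ≈⟨ *-congʳ (nonedge (x≢s ∘ ≡.sym) Asx≈0) ⟩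
        0# * minor L (v ∷ L′)     ≈⟨ zeroˡ _ ⟩
        0#                        ≈⟨ sign-zero xs ⟨
        -1^∣ xs ∣ 0#              ∎)
      (λ Asx≉0 → begin
        C s x * minor L (v ∷ L′)                       ≈⟨ *-congˡ (minor-moveʳ _ xs x ys) ⟩
        C s x * (-1^∣ xs ∣ minor (x ∷ L′) (v ∷ L′))    ≈⟨ *-congˡ (sign-cong xs (step Asx≉0)) ⟩
        C s x * (-1^∣ xs ∣ 0#)                         ≈⟨ *-sign xs _ _ ⟩
        -1^∣ xs ∣ (C s x * 0#)                         ≈⟨ sign-cong xs (zeroʳ _) ⟩
        -1^∣ xs ∣ 0#                                   ∎)
      where
      L′ : List (Fin n)
      L′ = xs ++ ys
      xpL′! : Unique (x ∷ vertices p ++ L′)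
      xpL′! = ≡.subst (λ vs → Unique (x ∷ vs)) (++-assoc (vertices p) xs ys)
        (unique-middle (vertices p ++ xs)
          (≡.subst Unique (≡.sym (++-assoc (vertices p) xs (x ∷ ys))) pL!))
      xp! : Unique (x ∷ vertices p)
      xp! = unique-++⁻ˡ (x ∷ vertices p) xpL′!
      source∈ : ∀ {s} (p : Star (Adj A) s v) → s ∈ vertices p
      source∈ ε       = here ≡.refl
      source∈ (_ ◅ _) = here ≡.refl
      x≢s : x ≢ s
      x≢s ≡.refl = ∉-head xp! (source∈ p)
      x≢v : x ≢ v
      x≢v ≡.refl = ∉-head xp! (target∈vertices p)
      -- The column `v` term vanishes since an edge from `x` to `v` would close a cycle with `p`.
      -- The other columns are the same claim for the path lengthened by `x`, with one vertex fewer
      -- in the list.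
      step : ¬ A s x ≈ 0# → minor (x ∷ L′) (v ∷ L′) ≈ 0#
      step Asx≉0 = begin
        C x v * minor L′ L′ - expand (C x) L′ (λ cs → minor L′ (v ∷ cs))
          ≈⟨ -‿cong₂ (*-congʳ (nonedge x≢v (trans (A-sym x v) (closing-edge e p 2≤∣p∣ xp!))))
               (tail-vanishes k (e ◅ p) (ℕ.m≤n⇒m≤1+n 2≤∣p∣) L′
                 (ℕ.suc-injective (≡.trans (≡.sym (length-++-sucʳ xs x ys)) ∣L∣≡k)) xpL′!) ⟩
        0# * minor L′ L′ - 0#  ≈⟨ x-0≈x _ ⟩
        0# * minor L′ L′       ≈⟨ zeroˡ _ ⟩
        0#                     ∎
        where
        e : Adj A x s
        e = Adj-sym (x≢s ∘ ≡.sym , Asx≉0)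

  -- Expanding along row `v`, the chosen column `w` sends the next expansion to row `w`. There
  -- column `v` gives `C w v` times the minor on the other vertices, and for an edge `v w` all other
  -- columns together contribute zero by `tail-vanishes`.
  vertex-recurrence : ∀ v L → Unique (v ∷ L) →
    principal (v ∷ L) ≈
    C v v * principal L - Σ[ L ] (λ w → C v w * (C w v * principal (without w L)))
  vertex-recurrence v L vL! = +-congˡ (-‿cong (expand≈Σ (C v) L _ _ term))
    where
    term : ∀ xs w ys → L ≡ xs ++ w ∷ ys → C v w * minor L (v ∷ xs ++ ys) ≈
           -1^∣ xs ∣ (C v w * (C w v * principal (without w L)))
    term xs w ys ≡.refl rewrite without-middle xs w ys (AllPairs.tail vL!) = begin
      C v w * minor (xs ++ w ∷ ys) (v ∷ L′)            ≈⟨ *-congˡ (minor-moveʳ _ xs w ys) ⟩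
      C v w * (-1^∣ xs ∣ minor (w ∷ L′) (v ∷ L′))      ≈⟨ *-sign xs _ _ ⟩
      -1^∣ xs ∣ (C v w * minor (w ∷ L′) (v ∷ L′))      ≈⟨ sign-cong xs (by-cases
        -- Without an edge both sides carry the factor `C v w`, which is zero.
        (λ Avw≈0 → trans (vanish (nonedge v≢w Avw≈0)) (sym (vanish (nonedge v≢w Avw≈0))))
        (λ Avw≉0 → *-congˡ (trans (+-congˡ (-‿cong (rest (v≢w , Avw≉0)))) (x-0≈x _)))) ⟩
      -1^∣ xs ∣ (C v w * (C w v * principal L′))       ∎
      where
      L′ : List (Fin n)
      L′ = xs ++ ys
      v≢w : v ≢ w
      v≢w = All.lookup (AllPairs.head vL!) (∈-++⁺ʳ xs (here ≡.refl))
      vanish : ∀ {x y} → x ≈ 0# → x * y ≈ 0#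
      vanish x≈0 = trans (*-congʳ x≈0) (zeroˡ _)
      rest : Adj A v w → expand (C w) L′ (λ cs → minor L′ (v ∷ cs)) ≈ 0#
      -- The starting path is the single edge from `w` to `v`; with its two vertices, any further
      -- vertex adjacent to both ends would complete a cycle.
      rest e = tail-vanishes _ (Adj-sym e ◅ ε) (s≤s (s≤s z≤n)) L′ ≡.refl
        (unique-middle (v ∷ xs) vL!)

  -- The eigenvector equation for the path vector.

  module PathVector (φ≈0 : φ A θ ≈ 0#) {u : Fin n} {α : Fin n → Carrier}
                    (isPathVector : IsPathVector A θ u α) where

    open IsPathVector isPathVector

    φ[A-_] : List (Fin n) → Carrier
    φ[A- U ] = principal (remaining U)

    α-path : ∀ {v} (p : Star (Adj A) u v) → Unique (vertices p) →
             α v ≈ edgeProduct p * φ[A- vertices p ]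
    α-path p p! = trans (connected (path p p!)) (*-congˡ (φ≈principal (vertices p)))

    -- Among the vertices of a path, its target is adjacent only to the last but one.
    predecessor-sum : ∀ {s w v} (q : Star (Adj A) s w) (e : Adj A w v) →
      Unique (vertices q ++ [ v ]) →
      Σ[ vertices q ] (λ x → A v x * α x) ≈ A v w * α w
    predecessor-sum ε       e q! = +-identityʳ _
    predecessor-sum {s} {w} {v} (f ◅ q) e (s∉ ∷ q!) = begin
      A v s * α s + Σ[ vertices q ] (λ x → A v x * α x)
        ≈⟨ +-cong (*-congʳ Avs≈0) (predecessor-sum q e q!) ⟩
      0# * α s + A v w * α w  ≈⟨ +-congʳ (zeroˡ _) ⟩
      0# + A v w * α w        ≈⟨ +-identityˡ _ ⟩
      A v w * α w             ∎
      where
      eq : vertices (q ◅◅ e ◅ ε) ≡ vertices q ++ [ v ]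
      eq = vertices-∷ʳ q e
      Avs≈0 : A v s ≈ 0#
      Avs≈0 = closing-edge f (q ◅◅ e ◅ ε)
        (≡.subst (2 ≤ₙ_)
          (≡.sym (≡.trans (≡.cong length eq) (≡.trans (length-++ (vertices q)) (ℕ.+-comm _ 1))))
          (s≤s (1≤∣vertices∣ q)))
        (≡.subst (λ vs → Unique (s ∷ vs)) (≡.sym eq) (s∉ ∷ q!))

    -- `Q` is the path without its target. Phrased through `Q`, the cases `v = u` and `v ≠ u` both
    -- supply the term φ(A - Q, θ) of the recurrence.
    ancestors : ∀ {v} (p : Star (Adj A) u v) → Unique (vertices p) →
      ∃ λ Q → vertices p ≡ Q ++ [ v ] ×
              Σ[ Q ] (λ x → A v x * α x) ≈ edgeProduct p * φ[A- Q ]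
    ancestors {v} p p! with snocView p
    -- For `v = u` there is no predecessor: the empty sum agrees with `φ A θ` because `θ` is a root.
    ... | nil = [] , ≡.refl , sym (begin
      1# * φ[A- [] ]        ≈⟨ *-identityˡ _ ⟩
      φ[A- [] ]             ≡⟨ ≡.cong principal remaining-[] ⟩
      principal (allFin n)  ≈⟨ φ≈principal-allFin ⟨
      φ A θ                 ≈⟨ φ≈0 ⟩
      0#                    ∎)
    ... | snoc {w} q e = vertices q , vertices-∷ʳ q e , (begin
      Σ[ vertices q ] (λ x → A v x * α x)            ≈⟨ predecessor-sum q e qv! ⟩
      A v w * α w                                    ≈⟨ *-cong (A-sym v w) (α-path q (unique-++⁻ˡ (vertices q) qv!)) ⟩
      A w v * (edgeProduct q * φ[A- vertices q ])    ≈⟨ x∙yz≈yx∙z _ _ _ ⟩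
      (edgeProduct q * A w v) * φ[A- vertices q ]    ≈⟨ *-congʳ (edgeProduct-∷ʳ q e) ⟨
      edgeProduct (q ◅◅ e ◅ ε) * φ[A- vertices q ]   ∎)
      where
      qv! : Unique (vertices q ++ [ v ])
      qv! = ≡.subst Unique (vertices-∷ʳ q e) p!

    -- Along an edge the path extends to `w`, which brings in `A v w` a second time, and the minus
    -- signs of the two off-diagonal entries of `C` cancel. Without an edge both sides are zero.
    descendant : ∀ {v} (p : Star (Adj A) u v) → Unique (vertices p) → ∀ {w} → w ∉ vertices p →
      A v w * α w ≈
      edgeProduct p * (C v w * (C w v * principal (without w (remaining (vertices p)))))
    descendant {v} p p! {w} w∉p = by-cases
      (λ Avw≈0 → begin
        A v w * α w                                ≈⟨ *-congʳ Avw≈0 ⟩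
        0# * α w                                   ≈⟨ zeroˡ _ ⟩
        0#                                         ≈⟨ zeroʳ _ ⟨
        edgeProduct p * 0#                         ≈⟨ *-congˡ (zeroˡ _) ⟨
        edgeProduct p * (0# * (C w v * D))         ≈⟨ *-congˡ (*-congʳ (nonedge v≢w Avw≈0)) ⟨
        edgeProduct p * (C v w * (C w v * D))      ∎)
      (λ Avw≉0 → begin
        A v w * α w
          ≈⟨ *-congˡ (α-extended (v≢w , Avw≉0)) ⟩
        A v w * ((edgeProduct p * A v w) * D)
          ≈⟨ *-congˡ (*-assoc _ _ _) ⟩
        A v w * (edgeProduct p * (A v w * D))
          ≈⟨ x∙yz≈y∙xz _ _ _ ⟩
        edgeProduct p * (A v w * (A v w * D))
          ≈⟨ *-congˡ signs ⟨
        edgeProduct p * (C v w * (C w v * D))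
          ∎)
      where
      D : Carrier
      D = principal (without w (remaining (vertices p)))
      v≢w : v ≢ w
      v≢w ≡.refl = w∉p (target∈vertices p)
      signs : C v w * (C w v * D) ≈ A v w * (A v w * D)
      signs = begin
        C v w * (C w v * D)          ≈⟨ *-cong (C-offDiagonal v≢w) (*-congʳ (C-offDiagonal (v≢w ∘ ≡.sym))) ⟩
        - A v w * (- A w v * D)      ≈⟨ *-congˡ (-‿distribˡ-* _ _) ⟨
        - A v w * (- (A w v * D))    ≈⟨ -‿distribˡ-* _ _ ⟨
        - (A v w * - (A w v * D))    ≈⟨ -‿cong (-‿distribʳ-* _ _) ⟨
        - (- (A v w * (A w v * D)))  ≈⟨ -‿involutive _ ⟩
        A v w * (A w v * D)          ≈⟨ *-congˡ (*-congʳ (A-sym w v)) ⟩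
        A v w * (A v w * D)          ∎
      α-extended : Adj A v w → α w ≈ (edgeProduct p * A v w) * D
      α-extended e = begin
        α w
          ≈⟨ α-path (p ◅◅ e ◅ ε) (≡.subst Unique (≡.sym (vertices-∷ʳ p e)) (unique-∷ʳ p! w∉p)) ⟩
        edgeProduct (p ◅◅ e ◅ ε) * φ[A- vertices (p ◅◅ e ◅ ε) ]
          ≈⟨ *-cong (edgeProduct-∷ʳ p e) (reflexive (≡.cong principal
               (≡.trans (≡.cong remaining (vertices-∷ʳ p e)) (remaining-∷ʳ (vertices p) w)))) ⟩
        (edgeProduct p * A v w) * D
          ∎

    Aα≈θα : ∀ v → sum (λ w → A v w * α w) ≈ θ * α v
    Aα≈θα v = by-cases on-component off-component
      where
      t : Fin n → Carrier
      t w = A v w * α w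

      on-component : Path A u v → sum t ≈ θ * α v
      -- The vertices fall into `Q`, `v` itself and the list `S` of vertices off the path, matching
      -- the three terms of the vertex recurrence for A - Q.
      on-component (path p p!) with Q , p≡Q∷ʳv , ΣQ ← ancestors p p!
        with xs , ys , remQ , rem ← remaining-split Q
               (∉-head (unique-middle Q (≡.subst Unique p≡Q∷ʳv p!)) ∘ ∈-++⁺ˡ) = begin
        sum t
          ≈⟨ sum≈Σ-tabulate id t ⟩
        Σ[ allFin n ] t
          ≈⟨ Σ-↭ t (allFin↭ Q!) ⟩
        Σ[ Q ++ remaining Q ] t
          ≈⟨ Σ-++ Q t ⟩
        Σ[ Q ] t + Σ[ remaining Q ] t
          ≈⟨ +-cong ΣQ (trans (reflexive (≡.cong (λ vs → Σ[ vs ] t) remQ)) (Σ-↭ t (shift v xs ys))) ⟩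
        W′ * φ[A- Q ] + (A v v * α v + Σ[ S ] t)
          ≈⟨ +-cong (*-congˡ recurrence) (+-cong (*-congˡ αv) ΣS) ⟩
        W′ * (C v v * principal S - T) + (A v v * (W′ * principal S) + W′ * T)
          ≈⟨ +-congʳ (x[y-z]≈xy-xz _ _ _) ⟩
        (W′ * (C v v * principal S) - W′ * T) + (A v v * (W′ * principal S) + W′ * T)
          ≈⟨ cancel _ _ _ ⟩
        W′ * (C v v * principal S) + A v v * (W′ * principal S)
          ≈⟨ +-congʳ (x∙yz≈y∙xz _ _ _) ⟩
        C v v * (W′ * principal S) + A v v * (W′ * principal S)
          ≈⟨ distribʳ _ _ _ ⟨
        (C v v + A v v) * (W′ * principal S)
          ≈⟨ *-cong C+A (sym αv) ⟩
        θ * α v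
          ∎
        where
        W′ = edgeProduct p
        S = xs ++ ys
        S≡ : S ≡ remaining (vertices p)
        S≡ = ≡.trans (≡.sym rem) (≡.cong remaining (≡.sym p≡Q∷ʳv))
        T = Σ[ S ] (λ w → C v w * (C w v * principal (without w S)))
        Q! : Unique Q
        Q! = unique-++⁻ˡ Q (≡.subst Unique p≡Q∷ʳv p!)
        recurrence : φ[A- Q ] ≈ C v v * principal S - T
        recurrence = begin
          φ[A- Q ]                         ≡⟨ ≡.cong principal remQ ⟩
          principal (xs ++ v ∷ ys)         ≈⟨ principal-move xs v ys ⟩
          principal (v ∷ S)                ≈⟨ vertex-recurrence v S (unique-middle xs
                                                (≡.subst Unique remQ (remaining-unique Q))) ⟩
          C v v * principal S - T          ∎
        αv : α v ≈ W′ * principal S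
        αv = trans (α-path p p!) (*-congˡ (reflexive (≡.cong principal (≡.sym S≡))))
        ΣS : Σ[ S ] t ≈ W′ * T
        ΣS = trans
          (Σ-cong S λ w w∈S → ≡.subst
            (λ vs → t w ≈ W′ * (C v w * (C w v * principal (without w vs)))) (≡.sym S≡)
            (descendant p p! (∈-remaining⁻ (vertices p) (≡.subst (w ∈_) S≡ w∈S))))
          (sym (*-distribˡ-Σ S W′ _))
        cancel : ∀ x y z → (x - y) + (z + y) ≈ x + z
        cancel x y z = begin
          (x - y) + (z + y)    ≈⟨ +-interchange x (- y) z y ⟩
          (x + z) + (- y + y)  ≈⟨ +-congˡ (-‿inverseˡ y) ⟩
          (x + z) + 0#         ≈⟨ +-identityʳ _ ⟩
          x + z                ∎
        C+A : C v v + A v v ≈ θ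
        C+A = begin
          C v v + A v v          ≈⟨ +-congʳ (C-diagonal v) ⟩
          (θ - A v v) + A v v    ≈⟨ +-assoc _ _ _ ⟩
          θ + (- A v v + A v v)  ≈⟨ +-congˡ (-‿inverseˡ _) ⟩
          θ + 0#                 ≈⟨ +-identityʳ θ ⟩
          θ                      ∎

      off-component : ¬ Path A u v → sum t ≈ θ * α v
      off-component ¬P = begin
        sum t                         ≈⟨ sum≈Σ-tabulate id t ⟩
        Σ[ allFin n ] t               ≈⟨ Σ-cong (allFin n) (λ w _ → t≈0 w) ⟩
        Σ[ allFin n ] (λ _ → 0#)      ≈⟨ Σ-zero (allFin n) ⟩
        0#                            ≈⟨ zeroʳ θ ⟨
        θ * 0#                        ≈⟨ *-congˡ (disconnected ¬P) ⟨
        θ * α v                       ∎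
        where
        α≈0⇒t≈0 : ∀ {w} → α w ≈ 0# → t w ≈ 0#
        α≈0⇒t≈0 αw≈0 = trans (*-congˡ αw≈0) (zeroʳ _)
        t≈0 : ∀ w → t w ≈ 0#
        t≈0 w with v Fin.≟ w
        ... | yes ≡.refl = α≈0⇒t≈0 (disconnected ¬P)
        ... | no v≢w     = by-cases
          (λ Avw≈0 → trans (*-congʳ Avw≈0) (zeroˡ _))
          -- A neighbour of `v` reachable from `u` would make `v` reachable, so `α` vanishes at `w`
          -- too.
          (λ Avw≉0 → α≈0⇒t≈0 (disconnected λ P → ¬P (extend P (Adj-sym (v≢w , Avw≉0)))))

    -- The vector is nonzero because the one-vertex path makes its entry at `u` equal to φ(A - u,
    -- θ).
    eigenvector : ¬ φ (A ∖ [ u ]) θ ≈ 0# → IsEigenvector A θ α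
    eigenvector φ≉0 = Aα≈θα , λ α≈0 → φ≉0 (begin
      φ (A ∖ [ u ]) θ       ≈⟨ *-identityˡ _ ⟨
      1# * φ (A ∖ [ u ]) θ  ≈⟨ connected (path ε ([] ∷ [])) ⟨
      α u                   ≈⟨ α≈0 u ⟩
      0#                    ∎)

-- Double negation stability of equality of Cauchy reals.

module ℝ-Stability where

  open Reals

  ∣a-b∣,∣b∣<½η⇒∣a∣<η : ∀ a b {η} → ℚ.∣ a ℚ.- b ∣ ℚ.< ½ ℚ.* η → ℚ.∣ b ∣ ℚ.< ½ ℚ.* η →
                      ℚ.∣ a ∣ ℚ.< η
  ∣a-b∣,∣b∣<½η⇒∣a∣<η a b {η} p q = begin-strict
    ℚ.∣ a ∣                         ≡⟨ ≡.cong ℚ.∣_∣ (GroupProperties.//-rightDividesˡ ℚ.+-0-group b a) ⟨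
    ℚ.∣ a ℚ.- b ℚ.+ b ∣             ≤⟨ ℚ.∣p+q∣≤∣p∣+∣q∣ (a ℚ.- b) b ⟩
    ℚ.∣ a ℚ.- b ∣ ℚ.+ ℚ.∣ b ∣       <⟨ ℚ.+-mono-< p q ⟩
    ½ ℚ.* η ℚ.+ ½ ℚ.* η             ≡⟨ ℚ.*-distribʳ-+ η ½ ½ ⟨
    ℚ.1ℚ ℚ.* η                      ≡⟨ ℚ.*-identityˡ η ⟩
    η                               ∎
    where open ℚ.≤-Reasoning

  Null : (ℕ → ℚ) → Set
  Null z = ∀ η → 0ℚ ℚ.< η → ∃ λ N → ∀ n → N ≤ₙ n → ℚ.∣ z n ∣ ℚ.< η

  -- Whether a Cauchy sequence is eventually below η is read off a single late
  -- term, and comparing that rational with η/2 is decidable.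
  null-stable : ∀ {z} → IsCauchy z → Stable (Null z)
  null-stable {z} z-cauchy ¬¬null η 0<η = decide (ℚ.∣ z m ∣ ℚ.<? ½η)
    where
    ½η = ½ ℚ.* η
    ¼η = ½ ℚ.* ½η
    0<½η : 0ℚ ℚ.< ½η
    0<½η = ℚ.*-monoʳ-<-pos ½ 0<η
    0<¼η : 0ℚ ℚ.< ¼η
    0<¼η = ℚ.*-monoʳ-<-pos ½ 0<½η
    -- From `K` on, terms are within η/2 of `z m`, so a value of `z m` below η/2 bounds them by η.
    -- From `L` on they are within η/4 of it, so an eventual bound η/4 would force `z m` below η/2.
    K = proj₁ (z-cauchy ½η 0<½η)
    L = proj₁ (z-cauchy ¼η 0<¼η)
    m = K ⊔ₙ L
    decide : Dec (ℚ.∣ z m ∣ ℚ.< ½η) → ∃ λ N → ∀ n → N ≤ₙ n → ℚ.∣ z n ∣ ℚ.< η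
    decide (yes small) = K , λ n K≤n → ∣a-b∣,∣b∣<½η⇒∣a∣<η (z n) (z m) {η}
      (proj₂ (z-cauchy ½η 0<½η) n m K≤n (ℕ.m≤m⊔n K L)) small
    decide (no ¬small) = contradiction not-null ¬¬null
      where
      not-null : ¬ Null z
      not-null null with N , z<¼η ← null ¼η 0<¼η =
        ¬small (∣a-b∣,∣b∣<½η⇒∣a∣<η (z m) (z (m ⊔ₙ N)) {½η}
          (proj₂ (z-cauchy ¼η 0<¼η) m (m ⊔ₙ N) L≤m (ℕ.≤-trans L≤m (ℕ.m≤m⊔n m N)))
          (z<¼η (m ⊔ₙ N) (ℕ.m≤n⊔m m N)))
        where L≤m = ℕ.m≤n⊔m K L

  -- Closeness of `x` and `y` unfolds to `Null` for the sequence of `x + - y`, which is Cauchy.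
  ≈-stable : ∀ x y → Stable (x ≈ y)
  close (≈-stable x y ¬¬x≈y) =
    null-stable (cauchy (x + - y)) (λ ¬null → ¬¬x≈y (¬null ∘ close))

-- Specialisation to real matrices.

open import Defs

theorem3p1 : (n : ℕ) (A : Matrix n) → Symmetric A → Acyclic A →
    (θ : ℝ) → IsEigenvalue A θ → HasMultiplicity A θ 1 →
    (u : Fin n) → ¬ (φ (A ∖ (u ∷ [])) θ ≈ 0#) →
    (α : Vector ℝ n) → IsPathVector A θ u α →
    IsEigenvector A θ α
theorem3p1 n A A-sym acyclic θ _ (q , φ≈[x-θ]q , _) u φ[A-u]≉0 α isPathVector =
  eigenvector φ[A-u]≉0
  where
  open CommutativeRing ℝ-commutativeRing using (trans; *-congʳ; zeroˡ; -‿inverseʳ)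
  φ≈0 : φ A θ ≈ 0#
  -- At the point `θ` the factor `(x - θ) ^ 1` of the characteristic polynomial is zero.
  φ≈0 = trans (φ≈[x-θ]q θ)
    (trans (*-congʳ (trans (*-congʳ (-‿inverseʳ θ)) (zeroˡ _))) (zeroˡ _))
  open Forest ℝ-commutativeRing ℝ-Stability.≈-stable A-sym acyclic θ using (module PathVector)
  open PathVector φ≈0 isPathVector using (eigenvector)
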